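{- For all SCL-terms $t$ and $t'$ (possibly containing variables), $$\mathrm{EqSSCL}\vdash t=t'\iff \mathrm{SSCL}\vdash t=t' .$$
   Context: Fix a countable set $A$ of atoms, treated as constants. $\curlywedge$ and $\curlyvee$ denote the binary connectives left-sequential (short-circuit) conjunction and disjunction. SCL-terms are terms built from variables, the constants $\mathsf T,\mathsf F$, atoms $a\in A$, the unary $\neg$ and the binary $\curlywedge,\curlyvee$. $\vdash$ is derivability in equational logic. $\mathrm{CP}_{mem}$ is the following set of axioms over the signature with constants $\mathsf T,\mathsf F$, atoms, and the ternary conditional $x\triangleleft y\triangleright z$ (read: if $y$ then $x$ else $z$): (CP1) $x\triangleleft\mathsf T\triangleright y=x$; (CP2) $x\triangleleft\mathsf F\triangleright y=y$; (CP3) $\mathsf T\triangleleft x\triangleright\mathsf F=x$; (CP4) $x\triangleleft(y\triangleleft z\triangleright u)\triangleright v=(x\triangleleft y\triangleright v)\triangleleft z\triangleright(x\triangleleft u\triangleright v)$; (CPmem) $x\triangleleft y\triangleright(z\triangleleft u\triangleright(v\triangleleft y\triangleright w))=x\triangleleft y\triangleright(z\triangleleft u\triangleright w)$. SSCL (static short-circuit logic): for SCL-terms $t,t'$, $\mathrm{SSCL}\vdash t=t'$ means that $t=t'$ is derivable in equational logic from $\mathrm{CP}_{mem}$ together with the axiom $\mathsf F\triangleleft x\triangleright\mathsf F=\mathsf F$ and the defining equations $\neg x=\mathsf F\triangleleft x\triangleright\mathsf T$, $x\curlywedge y=y\triangleleft x\triangleright\mathsf F$, and $x\curlyvee y=\neg(\neg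 x\curlywedge\neg y)$. EqSSCL is the following set of equations over SCL-terms: (SCL1) $\mathsf F=\neg\mathsf T$; (SCL2) $x\curlyvee y=\neg(\neg x\curlywedge\neg y)$; (SCL3) $\neg\neg x=x$; (SCL4) $\mathsf T\curlywedge x=x$; (SCL5) $x\curlywedge\mathsf T=x$; (SCL6) $\mathsf F\curlywedge x=\mathsf F$; (SCL7) $(x\curlywedge y)\curlywedge z=x\curlywedge(y\curlywedge z)$; (SCL8) $x\curlywedge\mathsf F=\neg x\curlywedge\mathsf F$; (MSCL1) $x\curlywedge(x\curlyvee y)=x$; (MSCL2) $x\curlywedge(y\curlyvee z)=(x\curlywedge y)\curlyvee(x\curlywedge z)$; (MSCL3) $(x\curlyvee y)\curlywedge(\neg x\curlyvee z)=(\neg x\curlyvee z)\curlywedge(x\curlyvee y)$; (MSCL4) $((x\curlywedge y)\curlyvee(\neg x\curlywedge z))\curlywedge u=(x\curlyvee(z\curlywedge u))\curlywedge(\neg x\curlyvee(y\curlywedge u))$; and the additional axiom $x\curlywedge\mathsf F=\mathsf F$. -}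

module Defs where

open import Data.Nat using (ℕ)
open import Data.Vec using (Vec; []; _∷_)
open import Data.Vec.Relation.Binary.Pointwise.Inductive using (Pointwise)
open import Level using (0ℓ)
open import Relation.Binary.Core using (Rel)

infix 8 ¬_
infix 7 _⋏_ _⋎_
infix 6 _◁_▷_
infix 4 _⊢_≈_

-- A signature is a family of operation symbols indexed by arity.  The
-- variables are drawn from the countably infinite set ℕ.

data Term (Op : ℕ → Set) : Set where
  var : ℕ → Term Op
  op  : {n : ℕ} → Op n → Vec (Term Op) n → Term Op

module _ {Op : ℕ → Set} where

  infix 9 _[_]

  mutual
    _[_] : Term Op → (ℕ → Term Op) → Term Op
    var i   [ σ ] = σ i
    op f ts [ σ ] = op f (substs ts σ)

    substs : {n : ℕ} → Vec (Term Op) n → (ℕ → Term Op) → Vec (Term Op) n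
    substs []       σ = []
    substs (t ∷ ts) σ = (t [ σ ]) ∷ substs ts σ

module _ {Op Op′ : ℕ → Set} (φ : {n : ℕ} → Op n → Op′ n) where

  mutual
    mapOp : Term Op → Term Op′
    mapOp (var i)   = var i
    mapOp (op f ts) = op (φ f) (mapOps ts)

    mapOps : {n : ℕ} → Vec (Term Op) n → Vec (Term Op′) n
    mapOps []       = []
    mapOps (t ∷ ts) = mapOp t ∷ mapOps ts

-- The equations in E are single equations between open terms, not schemes:
-- their instances come from the rule subst.

data _⊢_≈_ {Op : ℕ → Set} (E : Rel (Term Op) 0ℓ) : Rel (Term Op) 0ℓ where
  axiom : {s t : Term Op} → E s t → E ⊢ s ≈ t
  refl  : {t : Term Op} → E ⊢ t ≈ t
  sym   : {s t : Term Op} → E ⊢ s ≈ t → E ⊢ t ≈ s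
  trans : {s t u : Term Op} → E ⊢ s ≈ t → E ⊢ t ≈ u → E ⊢ s ≈ u
  subst : {s t : Term Op} (σ : ℕ → Term Op) →
          E ⊢ s ≈ t → E ⊢ s [ σ ] ≈ t [ σ ]
  cong  : {n : ℕ} (f : Op n) {ss ts : Vec (Term Op) n} →
          Pointwise (E ⊢_≈_) ss ts → E ⊢ op f ss ≈ op f ts

data SCLOp (A : Set) : ℕ → Set where
  true false : SCLOp A 0
  atom       : A → SCLOp A 0
  not        : SCLOp A 1
  and or     : SCLOp A 2

data SSCLOp (A : Set) : ℕ → Set where
  true false : SSCLOp A 0
  atom       : A → SSCLOp A 0
  not        : SSCLOp A 1
  and or     : SSCLOp A 2
  cond       : SSCLOp A 3

SCLTerm : Set → Set
SCLTerm A = Term (SCLOp A)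

SSCLTerm : Set → Set
SSCLTerm A = Term (SSCLOp A)

-- The operation symbols are overloaded, so these synonyms, other than the
-- conditional, serve for SCLTerm and SSCLTerm alike.

pattern T       = op true []
pattern F       = op false []
pattern ¬_ x    = op not (x ∷ [])
pattern _⋏_ x y = op and (x ∷ y ∷ [])
pattern _⋎_ x y = op or (x ∷ y ∷ [])

-- x ◁ y ▷ z is "if y then x else z".
pattern _◁_▷_ x y z = op cond (x ∷ y ∷ z ∷ [])

includeOp : {A : Set} {n : ℕ} → SCLOp A n → SSCLOp A n
includeOp true     = true
includeOp false    = false
includeOp (atom a) = atom a
includeOp not      = not
includeOp and      = and
includeOp or       = or

include : {A : Set} → SCLTerm A → SSCLTerm A
include = mapOp includeOp

private
  module _ {Op : ℕ → Set} where
    x y z u v w : Term Op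
    x = var 0
    y = var 1
    z = var 2
    u = var 3
    v = var 4
    w = var 5

data EqSSCL {A : Set} : Rel (SCLTerm A) 0ℓ where
  SCL1  : EqSSCL F (¬ T)
  SCL2  : EqSSCL (x ⋎ y) (¬ ((¬ x) ⋏ (¬ y)))
  SCL3  : EqSSCL (¬ (¬ x)) x
  SCL4  : EqSSCL (T ⋏ x) x
  SCL5  : EqSSCL (x ⋏ T) x
  SCL6  : EqSSCL (F ⋏ x) F
  SCL7  : EqSSCL ((x ⋏ y) ⋏ z) (x ⋏ (y ⋏ z))
  SCL8  : EqSSCL (x ⋏ F) ((¬ x) ⋏ F)
  MSCL1 : EqSSCL (x ⋏ (x ⋎ y)) x
  MSCL2 : EqSSCL (x ⋏ (y ⋎ z)) ((x ⋏ y) ⋎ (x ⋏ z))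
  MSCL3 : EqSSCL ((x ⋎ y) ⋏ ((¬ x) ⋎ z)) (((¬ x) ⋎ z) ⋏ (x ⋎ y))
  MSCL4 : EqSSCL (((x ⋏ y) ⋎ ((¬ x) ⋏ z)) ⋏ u)
                 ((x ⋎ (z ⋏ u)) ⋏ ((¬ x) ⋎ (y ⋏ u)))
  x⋏F≈F : EqSSCL (x ⋏ F) F

data CPmem {A : Set} : Rel (SSCLTerm A) 0ℓ where
  CP1     : CPmem (x ◁ T ▷ y) x
  CP2     : CPmem (x ◁ F ▷ y) y
  CP3     : CPmem (T ◁ x ▷ F) x
  CP4     : CPmem (x ◁ (y ◁ z ▷ u) ▷ v) ((x ◁ y ▷ v) ◁ z ▷ (x ◁ u ▷ v))
  CPmemax : CPmem (x ◁ y ▷ (z ◁ u ▷ (v ◁ y ▷ w))) (x ◁ y ▷ (z ◁ u ▷ w))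

data SSCL {A : Set} : Rel (SSCLTerm A) 0ℓ where
  cpmem  : {s t : SSCLTerm A} → CPmem s t → SSCL s t
  static : SSCL (F ◁ x ▷ F) F
  def-¬  : SSCL (¬ x) (F ◁ x ▷ T)
  def-⋏  : SSCL (x ⋏ y) (y ◁ x ▷ F)
  def-⋎  : SSCL (x ⋎ y) (¬ ((¬ x) ⋏ (¬ y)))

{-# OPTIONS --safe #-}

-- Both theories axiomatise Boolean algebras: by the static axioms the order
-- of evaluation becomes irrelevant, so _⋏_ is commutative.  Hence the terms
-- modulo either theory form a Boolean algebra.  Conversely every Boolean
-- algebra, with x ◁ y ▷ z read as (y ∧ x) ∨ (¬ y ∧ z), is a model of both
-- sets of axioms, which are propositional tautologies.  Each implication then
-- follows by evaluating a derivation in one theory in the term algebra of the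
-- other.

module Submission where

open import Algebra.Core using (Op₁; Op₂)
import Algebra.Definitions as Definitions
open import Algebra.Lattice.Bundles using (BooleanAlgebra)
open import Algebra.Lattice.Structures.Biased
  using (isBooleanAlgebraʳ; isDistributiveLatticeʳʲᵐ)
import Algebra.Lattice.Properties.BooleanAlgebra as BooleanAlgebraProperties
import Algebra.Lattice.Properties.BooleanAlgebra.Expression as Expression
open import Data.Bool.Base as Bool using (Bool)
open import Data.List.Base using (List; []; _∷_)
open import Data.Nat using (ℕ; zero; suc)
open import Data.Product.Base using (_,_)
open import Data.Vec.Base as Vec using (Vec; []; _∷_)
open import Data.Vec.Properties using (lookup-map)
open import Data.Vec.Relation.Binary.Pointwise.Inductive as Pointwise
  using (Pointwise; []; _∷_)
open import Function.Base using (_∘_)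
open import Function.Bundles using (_↣_; _⇔_; mk⇔)
import Function.Identity.Effectful as Identity
open import Level using (0ℓ)
open import Relation.Binary.Bundles using (Setoid)
open import Relation.Binary.Core using (Rel)
open import Relation.Binary.PropositionalEquality.Core as ≡ using (_≡_)
import Relation.Binary.Reasoning.Setoid as ≈-Reasoning
import Relation.Binary.Reflection as Reflection

-- A decision procedure for equations in Boolean algebras.

module BooleanSolver (B : BooleanAlgebra 0ℓ 0ℓ) where

  open BooleanAlgebra B renaming (¬_ to ∼_)
  open BooleanAlgebraProperties B
  open Expression B using (Expr; module Semantics) public
  open Expr public
    renaming ( _or_ to infixr 6 _∨′_; _and_ to infixr 7 _∧′_; not to infix 8 ¬′_
             ; top to ⊤′; bot to ⊥′)
  open Semantics Identity.applicative using (⟦_⟧)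
  open ≈-Reasoning setoid

  private
    variable
      n : ℕ
      x a a′ b b′ : Carrier

  infix 5 _if_else_

  -- Unfolds to the same formula as the reading of `cond` in `BooleanModel`, so that the validity
  -- goals for the conditional match literally.
  _if_else_ : Expr n → Expr n → Expr n → Expr n
  e if c else e′ = (c ∧′ e) ∨′ (¬′ c ∧′ e′)

  eval : Expr n → Vec Bool n → Bool
  eval (var i)    β = Vec.lookup β i
  eval (e ∨′ e′)  β = eval e β Bool.∨ eval e′ β
  eval (e ∧′ e′)  β = eval e β Bool.∧ eval e′ β
  eval (¬′ e)     β = Bool.not (eval e β)
  eval ⊤′         β = Bool.true
  eval ⊥′         β = Bool.false

  fromBool : Bool → Carrier
  fromBool Bool.true  = ⊤
  fromBool Bool.false = ⊥

  fromBool-∧ : ∀ p q → fromBool p ∧ fromBool q ≈ fromBool (p Bool.∧ q)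
  fromBool-∧ Bool.true  q = ∧-identityˡ _
  fromBool-∧ Bool.false q = ∧-zeroˡ _

  fromBool-∨ : ∀ p q → fromBool p ∨ fromBool q ≈ fromBool (p Bool.∨ q)
  fromBool-∨ Bool.true  q = ∨-zeroˡ _
  fromBool-∨ Bool.false q = ∨-identityˡ _

  fromBool-not : ∀ p → ∼ fromBool p ≈ fromBool (Bool.not p)
  fromBool-not Bool.true  = ¬⊤≈⊥
  fromBool-not Bool.false = ¬⊥≈⊤

  -- `fromBool` is a homomorphism from the two-element Boolean algebra.
  ⟦⟧-fromBool : (e : Expr n) (β : Vec Bool n) →
                ⟦ e ⟧ (Vec.map fromBool β) ≈ fromBool (eval e β)
  ⟦⟧-fromBool (var i) β = reflexive (lookup-map i fromBool β)
  ⟦⟧-fromBool (e ∨′ e′) β =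
    trans (∨-cong (⟦⟧-fromBool e β) (⟦⟧-fromBool e′ β)) (fromBool-∨ (eval e β) _)
  ⟦⟧-fromBool (e ∧′ e′) β =
    trans (∧-cong (⟦⟧-fromBool e β) (⟦⟧-fromBool e′ β)) (fromBool-∧ (eval e β) _)
  ⟦⟧-fromBool (¬′ e) β =
    trans (¬-cong (⟦⟧-fromBool e β)) (fromBool-not (eval e β))
  ⟦⟧-fromBool ⊤′ β = refl
  ⟦⟧-fromBool ⊥′ β = refl

  -- The congruence modulo the principal filter of `x`.
  EqualBelow : Carrier → Rel Carrier 0ℓ
  EqualBelow x a b = x ∧ a ≈ x ∧ b

  ∧-equalBelow : EqualBelow x a a′ → EqualBelow x b b′ →
                 EqualBelow x (a ∧ b) (a′ ∧ b′)
  ∧-equalBelow {x} {a} {a′} {b} {b′} p q = begin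
    x ∧ (a ∧ b)    ≈⟨ ∧-assoc x a b ⟨
    (x ∧ a) ∧ b    ≈⟨ ∧-congʳ (trans p (∧-comm x a′)) ⟩
    (a′ ∧ x) ∧ b   ≈⟨ ∧-assoc a′ x b ⟩
    a′ ∧ (x ∧ b)   ≈⟨ ∧-congˡ q ⟩
    a′ ∧ (x ∧ b′)  ≈⟨ ∧-assoc a′ x b′ ⟨
    (a′ ∧ x) ∧ b′  ≈⟨ ∧-congʳ (∧-comm a′ x) ⟩
    (x ∧ a′) ∧ b′  ≈⟨ ∧-assoc x a′ b′ ⟩
    x ∧ (a′ ∧ b′)  ∎

  ∨-equalBelow : EqualBelow x a a′ → EqualBelow x b b′ →
                 EqualBelow x (a ∨ b) (a′ ∨ b′)
  ∨-equalBelow {x} {a} {a′} {b} {b′} p q = begin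
    x ∧ (a ∨ b)           ≈⟨ ∧-distribˡ-∨ x a b ⟩
    (x ∧ a) ∨ (x ∧ b)     ≈⟨ ∨-cong p q ⟩
    (x ∧ a′) ∨ (x ∧ b′)   ≈⟨ ∧-distribˡ-∨ x a′ b′ ⟨
    x ∧ (a′ ∨ b′)         ∎

  -- Below `x`, a complement depends only on the part of its argument below `x`, which is what
  -- `¬-equalBelow` needs.
  x∧¬[x∧a]≈x∧¬a : ∀ x a → x ∧ ∼ (x ∧ a) ≈ x ∧ ∼ a
  x∧¬[x∧a]≈x∧¬a x a = begin
    x ∧ ∼ (x ∧ a)            ≈⟨ ∧-congˡ (deMorgan₁ x a) ⟩
    x ∧ (∼ x ∨ ∼ a)          ≈⟨ ∧-distribˡ-∨ x (∼ x) (∼ a) ⟩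
    (x ∧ ∼ x) ∨ (x ∧ ∼ a)    ≈⟨ ∨-congʳ (∧-complementʳ x) ⟩
    ⊥ ∨ (x ∧ ∼ a)            ≈⟨ ∨-identityˡ _ ⟩
    x ∧ ∼ a                  ∎

  ¬-equalBelow : EqualBelow x a a′ → EqualBelow x (∼ a) (∼ a′)
  ¬-equalBelow {x} {a} {a′} p = begin
    x ∧ ∼ a          ≈⟨ x∧¬[x∧a]≈x∧¬a x a ⟨
    x ∧ ∼ (x ∧ a)    ≈⟨ ∧-congˡ (¬-cong p) ⟩
    x ∧ ∼ (x ∧ a′)   ≈⟨ x∧¬[x∧a]≈x∧¬a x a′ ⟩
    x ∧ ∼ a′         ∎

  -- Compatibility with all principal filter congruences. It stands in for being given by an
  -- expression, and unlike that it passes directly to a function with its first argument fixed.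
  Local : (Vec Carrier n → Carrier) → Set
  Local f = ∀ {x us vs} → Pointwise (EqualBelow x) us vs →
            EqualBelow x (f us) (f vs)

  ⟦⟧-local : (e : Expr n) → Local ⟦ e ⟧
  ⟦⟧-local (var i)   ps = Pointwise.lookup ps i
  ⟦⟧-local (e ∨′ e′) ps = ∨-equalBelow (⟦⟧-local e ps) (⟦⟧-local e′ ps)
  ⟦⟧-local (e ∧′ e′) ps = ∧-equalBelow (⟦⟧-local e ps) (⟦⟧-local e′ ps)
  ⟦⟧-local (¬′ e)    ps = ¬-equalBelow (⟦⟧-local e ps)
  ⟦⟧-local ⊤′        ps = refl
  ⟦⟧-local ⊥′        ps = refl

  local-∷ : {f : Vec Carrier (ℕ.suc n) → Carrier} → Local f →
            ∀ a → Local (f ∘ (a ∷_))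
  local-∷ f-local a ps = f-local (refl ∷ ps)

  -- A local function is determined by its values at ⊤ and ⊥, so the Shannon
  -- tree of its truth table is a normal form.
  shannon : (Vec Bool n → Bool) → Vec Carrier n → Carrier
  shannon g []      = fromBool (g [])
  shannon g (x ∷ ρ) = (x ∧ shannon (g ∘ (Bool.true ∷_)) ρ) ∨
                      (∼ x ∧ shannon (g ∘ (Bool.false ∷_)) ρ)

  -- Induction on the number of arguments: the two halves of the truth table `g` belong to the
  -- cofactors of `f` at `⊤` and `⊥`, which are again local.
  shannon-correct : (f : Vec Carrier n → Carrier) (g : Vec Bool n → Bool) →
                    Local f →
                    (∀ β → f (Vec.map fromBool β) ≈ fromBool (g β)) →
                    ∀ ρ → shannon g ρ ≈ f ρ
  shannon-correct f g f-local f≈g []      = sym (f≈g [])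
  shannon-correct f g f-local f≈g (x ∷ ρ) = begin
    (x ∧ shannon (g ∘ (Bool.true ∷_)) ρ) ∨ (∼ x ∧ shannon (g ∘ (Bool.false ∷_)) ρ)
      ≈⟨ ∨-cong
           (∧-congˡ (shannon-correct (f ∘ (⊤ ∷_)) _ (local-∷ f-local ⊤)
                       (f≈g ∘ (Bool.true ∷_)) ρ))
           (∧-congˡ (shannon-correct (f ∘ (⊥ ∷_)) _ (local-∷ f-local ⊥)
                       (f≈g ∘ (Bool.false ∷_)) ρ)) ⟩
    (x ∧ f (⊤ ∷ ρ)) ∨ (∼ x ∧ f (⊥ ∷ ρ))
      -- Below `x` the element `x` agrees with `⊤`, and below `∼ x` with `⊥`, so locality puts `x`
      -- back in both cofactors.
      ≈⟨ ∨-cong (f-local (x≈⊤ ∷ Pointwise.refl refl))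
                (f-local (x≈⊥ ∷ Pointwise.refl refl)) ⟩
    (x ∧ f (x ∷ ρ)) ∨ (∼ x ∧ f (x ∷ ρ))  ≈⟨ ∧-distribʳ-∨ (f (x ∷ ρ)) x (∼ x) ⟨
    (x ∨ ∼ x) ∧ f (x ∷ ρ)                ≈⟨ ∧-congʳ (∨-complementʳ x) ⟩
    ⊤ ∧ f (x ∷ ρ)                        ≈⟨ ∧-identityˡ _ ⟩
    f (x ∷ ρ)                            ∎
    where
    x≈⊤ : EqualBelow x ⊤ x
    x≈⊤ = trans (∧-identityʳ x) (sym (∧-idem x))
    x≈⊥ : EqualBelow (∼ x) ⊥ x
    x≈⊥ = trans (∧-zeroʳ (∼ x)) (sym (∧-complementˡ x))

  -- The normal form depends only on the truth table, which computes for a concrete expression.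
  -- Hence for a tautological equation the two normal forms coincide definitionally, and reflexivity
  -- is all that `solve` has to be given.
  open Reflection setoid var ⟦_⟧ (shannon ∘ eval)
    (λ e → shannon-correct ⟦ e ⟧ (eval e) (⟦⟧-local e) (⟦⟧-fromBool e))
    public using (solve; _⊜_)

-- Boolean algebras from laws of conjunction and an involutive negation.

module DeMorganAlgebra (S : Setoid 0ℓ 0ℓ) where

  open Setoid S
  open Definitions _≈_
  open ≈-Reasoning S

  module _
    (_∧_ _∨_ : Op₂ Carrier) (∼_ : Op₁ Carrier) (⊤ ⊥ : Carrier)
    (∧-cong : Congruent₂ _∧_) (¬-cong : Congruent₁ ∼_)
    (¬-involutive : Involutive ∼_)
    (⊥≈¬⊤ : ⊥ ≈ (∼ ⊤))
    (∨-def : ∀ x y → (x ∨ y) ≈ (∼ ((∼ x) ∧ (∼ y))))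
    (∧-assoc : Associative _∧_) (∧-comm : Commutative _∧_)
    (∧-absorbs-∨ : _∧_ Absorbs _∨_) (∧-distribˡ-∨ : _∧_ DistributesOverˡ _∨_)
    (∧-complementʳ : RightInverse ⊥ ∼_ _∧_)
    where

    ∨-cong : Congruent₂ _∨_
    ∨-cong {x} {y} {u} {v} p q = begin
      x ∨ u                ≈⟨ ∨-def x u ⟩
      ∼ ((∼ x) ∧ (∼ u))    ≈⟨ ¬-cong (∧-cong (¬-cong p) (¬-cong q)) ⟩
      ∼ ((∼ y) ∧ (∼ v))    ≈⟨ ∨-def y v ⟨
      y ∨ v                ∎

    ¬-∨ : ∀ x y → (∼ (x ∨ y)) ≈ ((∼ x) ∧ (∼ y))
    ¬-∨ x y = trans (¬-cong (∨-def x y)) (¬-involutive _)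

    ¬-∧ : ∀ x y → (∼ (x ∧ y)) ≈ ((∼ x) ∨ (∼ y))
    ¬-∧ x y = begin
      ∼ (x ∧ y)
        ≈⟨ ¬-cong (∧-cong (¬-involutive x) (¬-involutive y)) ⟨
      ∼ ((∼ (∼ x)) ∧ (∼ (∼ y)))          ≈⟨ ∨-def _ _ ⟨
      (∼ x) ∨ (∼ y)                      ∎

    -- The duality principle: negating both sides turns each law of `_∨_` below into a law of `_∧_`.
    ¬-injective : ∀ {x y} → (∼ x) ≈ (∼ y) → x ≈ y
    ¬-injective {x} {y} p =
      trans (sym (¬-involutive x)) (trans (¬-cong p) (¬-involutive y))

    ∨-comm : Commutative _∨_
    ∨-comm x y = ¬-injective (begin
      ∼ (x ∨ y)      ≈⟨ ¬-∨ x y ⟩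
      (∼ x) ∧ (∼ y)  ≈⟨ ∧-comm _ _ ⟩
      (∼ y) ∧ (∼ x)  ≈⟨ ¬-∨ y x ⟨
      ∼ (y ∨ x)      ∎)

    ∨-assoc : Associative _∨_
    ∨-assoc x y z = ¬-injective (begin
      ∼ ((x ∨ y) ∨ z)            ≈⟨ ¬-∨ _ z ⟩
      (∼ (x ∨ y)) ∧ (∼ z)        ≈⟨ ∧-cong (¬-∨ x y) refl ⟩
      ((∼ x) ∧ (∼ y)) ∧ (∼ z)    ≈⟨ ∧-assoc _ _ _ ⟩
      (∼ x) ∧ ((∼ y) ∧ (∼ z))    ≈⟨ ∧-cong refl (¬-∨ y z) ⟨
      (∼ x) ∧ (∼ (y ∨ z))        ≈⟨ ¬-∨ x _ ⟨
      ∼ (x ∨ (y ∨ z))            ∎)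

    ∨-absorbs-∧ : _∨_ Absorbs _∧_
    ∨-absorbs-∧ x y = ¬-injective (begin
      ∼ (x ∨ (x ∧ y))            ≈⟨ ¬-∨ x _ ⟩
      (∼ x) ∧ (∼ (x ∧ y))        ≈⟨ ∧-cong refl (¬-∧ x y) ⟩
      (∼ x) ∧ ((∼ x) ∨ (∼ y))    ≈⟨ ∧-absorbs-∨ _ _ ⟩
      ∼ x                        ∎)

    ∨-distribʳ-∧ : _∨_ DistributesOverʳ _∧_
    ∨-distribʳ-∧ x y z = ¬-injective (begin
      -- Dualising `∧-distribˡ-∨` gives the left-handed law; commutativity at both ends makes it
      -- right-handed.
      ∼ ((y ∧ z) ∨ x)                            ≈⟨ ¬-cong (∨-comm _ x) ⟩
      ∼ (x ∨ (y ∧ z))                            ≈⟨ ¬-∨ x _ ⟩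
      (∼ x) ∧ (∼ (y ∧ z))                        ≈⟨ ∧-cong refl (¬-∧ y z) ⟩
      (∼ x) ∧ ((∼ y) ∨ (∼ z))                    ≈⟨ ∧-distribˡ-∨ _ _ _ ⟩
      ((∼ x) ∧ (∼ y)) ∨ ((∼ x) ∧ (∼ z))          ≈⟨ ∨-cong (¬-∨ x y) (¬-∨ x z) ⟨
      (∼ (x ∨ y)) ∨ (∼ (x ∨ z))                  ≈⟨ ¬-∧ _ _ ⟨
      ∼ ((x ∨ y) ∧ (x ∨ z))
        ≈⟨ ¬-cong (∧-cong (∨-comm x y) (∨-comm x z)) ⟩
      ∼ ((y ∨ x) ∧ (z ∨ x))                      ∎)

    ∨-complementʳ : RightInverse ⊤ ∼_ _∨_
    ∨-complementʳ x = ¬-injective (begin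
      ∼ (x ∨ (∼ x))        ≈⟨ ¬-∨ x _ ⟩
      (∼ x) ∧ (∼ (∼ x))    ≈⟨ ∧-complementʳ _ ⟩
      ⊥                    ≈⟨ ⊥≈¬⊤ ⟩
      ∼ ⊤                  ∎)

    booleanAlgebra : BooleanAlgebra 0ℓ 0ℓ
    booleanAlgebra = record
      { isBooleanAlgebra = isBooleanAlgebraʳ (record
        { isDistributiveLattice = isDistributiveLatticeʳʲᵐ (record
          { isLattice = record
            { isEquivalence = isEquivalence
            ; ∨-comm        = ∨-comm
            ; ∨-assoc       = ∨-assoc
            ; ∨-cong        = ∨-cong
            ; ∧-comm        = ∧-comm
            ; ∧-assoc       = ∧-assoc
            ; ∧-cong        = ∧-cong
            ; absorptive    = ∨-absorbs-∧ , ∧-absorbs-∨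
            }
          ; ∨-distribʳ-∧ = ∨-distribʳ-∧
          })
        ; ∨-complementʳ = ∨-complementʳ
        ; ∧-complementʳ = ∧-complementʳ
        ; ¬-cong        = ¬-cong
        })
      }

open import Defs

-- Evaluation of terms and soundness of equational logic.

module Evaluation {Op : ℕ → Set} {C : Set}
                  (⟦_⟧ : {n : ℕ} → Op n → Vec C n → C) where

  mutual
    eval : Term Op → (ℕ → C) → C
    eval (var i)   ρ = ρ i
    eval (op f ts) ρ = ⟦ f ⟧ (evals ts ρ)

    evals : {n : ℕ} → Vec (Term Op) n → (ℕ → C) → Vec C n
    evals []       ρ = []
    evals (t ∷ ts) ρ = eval t ρ ∷ evals ts ρ

  mutual
    eval-[] : ∀ t (σ : ℕ → Term Op) ρ →
              eval (t [ σ ]) ρ ≡ eval t (λ i → eval (σ i) ρ)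
    eval-[] (var i)   σ ρ = ≡.refl
    eval-[] (op f ts) σ ρ = ≡.cong ⟦ f ⟧ (evals-substs ts σ ρ)

    evals-substs : {n : ℕ} (ts : Vec (Term Op) n) (σ : ℕ → Term Op) (ρ : ℕ → C) →
                   evals (substs ts σ) ρ ≡ evals ts (λ i → eval (σ i) ρ)
    evals-substs []       σ ρ = ≡.refl
    evals-substs (t ∷ ts) σ ρ =
      ≡.cong₂ _∷_ (eval-[] t σ ρ) (evals-substs ts σ ρ)

module Soundness {Op : ℕ → Set} {E : Rel (Term Op) 0ℓ} (S : Setoid 0ℓ 0ℓ) where

  open Setoid S using (Carrier; _≈_)

  module _ (⟦_⟧ : {n : ℕ} → Op n → Vec Carrier n → Carrier) where

    open Evaluation ⟦_⟧

    module _
      (⟦⟧-cong : {n : ℕ} (f : Op n) {us vs : Vec Carrier n} →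
                 Pointwise _≈_ us vs → ⟦ f ⟧ us ≈ ⟦ f ⟧ vs)
      (axioms : ∀ {s t} → E s t → ∀ ρ → eval s ρ ≈ eval t ρ)
      where

      mutual
        sound : ∀ {s t} → E ⊢ s ≈ t → ∀ ρ → eval s ρ ≈ eval t ρ
        sound (axiom e)   ρ = axioms e ρ
        sound refl        ρ = Setoid.refl S
        sound (sym p)     ρ = Setoid.sym S (sound p ρ)
        sound (trans p q) ρ = Setoid.trans S (sound p ρ) (sound q ρ)
        -- By the substitution lemma the premise is needed at another valuation, so the induction
        -- must leave `ρ` general.
        sound (subst {s} {t} σ p) ρ
          rewrite eval-[] s σ ρ | eval-[] t σ ρ = sound p (λ i → eval (σ i) ρ)
        sound (cong f ps) ρ = ⟦⟧-cong f (sounds ps ρ)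

        sounds : {n : ℕ} {ss ts : Vec (Term Op) n} → Pointwise (E ⊢_≈_) ss ts →
                 ∀ ρ → Pointwise _≈_ (evals ss ρ) (evals ts ρ)
        sounds []       ρ = []
        sounds (p ∷ ps) ρ = sound p ρ ∷ sounds ps ρ

-- Boolean algebras as models of both theories.

module BooleanModel {A : Set} (B : BooleanAlgebra 0ℓ 0ℓ)
                    (α : A → BooleanAlgebra.Carrier B) where

  open BooleanAlgebra B hiding (sym; trans) renaming (¬_ to ∼_; refl to ≈-refl)
  open BooleanSolver B hiding (eval)

  ⟦_⟧ : {n : ℕ} → SSCLOp A n → Vec Carrier n → Carrier
  ⟦ true   ⟧ []               = ⊤
  ⟦ false  ⟧ []               = ⊥
  ⟦ atom a ⟧ []               = α a
  ⟦ not    ⟧ (x ∷ [])         = ∼ x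
  ⟦ and    ⟧ (x ∷ y ∷ [])     = x ∧ y
  ⟦ or     ⟧ (x ∷ y ∷ [])     = x ∨ y
  ⟦ cond   ⟧ (x ∷ y ∷ z ∷ []) = (y ∧ x) ∨ (∼ y ∧ z)

  ⟦⟧-cong : {n : ℕ} (f : SSCLOp A n) {us vs : Vec Carrier n} →
            Pointwise _≈_ us vs → ⟦ f ⟧ us ≈ ⟦ f ⟧ vs
  ⟦⟧-cong true     []               = ≈-refl
  ⟦⟧-cong false    []               = ≈-refl
  ⟦⟧-cong (atom a) []               = ≈-refl
  ⟦⟧-cong not      (p ∷ [])         = ¬-cong p
  ⟦⟧-cong and      (p ∷ q ∷ [])     = ∧-cong p q
  ⟦⟧-cong or       (p ∷ q ∷ [])     = ∨-cong p q
  ⟦⟧-cong cond     (p ∷ q ∷ r ∷ []) = ∨-cong (∧-cong q p) (∧-cong (¬-cong q) r)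

  module OnSCL  = Evaluation {SCLOp A} (λ f → ⟦ includeOp f ⟧)
  module OnSSCL = Evaluation ⟦_⟧

  eqSSCL-valid : ∀ {s t} → EqSSCL s t → ∀ ρ → OnSCL.eval s ρ ≈ OnSCL.eval t ρ
  eqSSCL-valid SCL1 ρ = solve 0 (⊥′ ⊜ ¬′ ⊤′) ≈-refl
  eqSSCL-valid SCL2 ρ =
    solve 2 (λ x y → x ∨′ y ⊜ ¬′ (¬′ x ∧′ ¬′ y)) ≈-refl (ρ 0) (ρ 1)
  eqSSCL-valid SCL3 ρ = solve 1 (λ x → ¬′ (¬′ x) ⊜ x) ≈-refl (ρ 0)
  eqSSCL-valid SCL4 ρ = solve 1 (λ x → ⊤′ ∧′ x ⊜ x) ≈-refl (ρ 0)
  eqSSCL-valid SCL5 ρ = solve 1 (λ x → x ∧′ ⊤′ ⊜ x) ≈-refl (ρ 0)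
  eqSSCL-valid SCL6 ρ = solve 1 (λ x → ⊥′ ∧′ x ⊜ ⊥′) ≈-refl (ρ 0)
  eqSSCL-valid SCL7 ρ =
    solve 3 (λ x y z → (x ∧′ y) ∧′ z ⊜ x ∧′ (y ∧′ z)) ≈-refl (ρ 0) (ρ 1) (ρ 2)
  eqSSCL-valid SCL8 ρ = solve 1 (λ x → x ∧′ ⊥′ ⊜ ¬′ x ∧′ ⊥′) ≈-refl (ρ 0)
  eqSSCL-valid MSCL1 ρ = solve 2 (λ x y → x ∧′ (x ∨′ y) ⊜ x) ≈-refl (ρ 0) (ρ 1)
  eqSSCL-valid MSCL2 ρ =
    solve 3 (λ x y z → x ∧′ (y ∨′ z) ⊜ (x ∧′ y) ∨′ (x ∧′ z)) ≈-refl
      (ρ 0) (ρ 1) (ρ 2)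
  eqSSCL-valid MSCL3 ρ =
    solve 3 (λ x y z → (x ∨′ y) ∧′ (¬′ x ∨′ z) ⊜ (¬′ x ∨′ z) ∧′ (x ∨′ y)) ≈-refl
      (ρ 0) (ρ 1) (ρ 2)
  eqSSCL-valid MSCL4 ρ =
    solve 4 (λ x y z u → ((x ∧′ y) ∨′ (¬′ x ∧′ z)) ∧′ u ⊜
                         (x ∨′ (z ∧′ u)) ∧′ (¬′ x ∨′ (y ∧′ u))) ≈-refl
      (ρ 0) (ρ 1) (ρ 2) (ρ 3)
  eqSSCL-valid x⋏F≈F ρ = solve 1 (λ x → x ∧′ ⊥′ ⊜ ⊥′) ≈-refl (ρ 0)

  sscl-valid : ∀ {s t} → SSCL s t → ∀ ρ → OnSSCL.eval s ρ ≈ OnSSCL.eval t ρ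
  sscl-valid (cpmem CP1) ρ = solve 2 (λ x y → x if ⊤′ else y ⊜ x) ≈-refl (ρ 0) (ρ 1)
  sscl-valid (cpmem CP2) ρ = solve 2 (λ x y → x if ⊥′ else y ⊜ y) ≈-refl (ρ 0) (ρ 1)
  sscl-valid (cpmem CP3) ρ = solve 1 (λ x → ⊤′ if x else ⊥′ ⊜ x) ≈-refl (ρ 0)
  sscl-valid (cpmem CP4) ρ =
    solve 5 (λ x y z u v → x if (y if z else u) else v ⊜
                           (x if y else v) if z else (x if u else v)) ≈-refl
      (ρ 0) (ρ 1) (ρ 2) (ρ 3) (ρ 4)
  sscl-valid (cpmem CPmemax) ρ =
    solve 6 (λ x y z u v w → x if y else (z if u else (v if y else w)) ⊜
                             x if y else (z if u else w)) ≈-refl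
      (ρ 0) (ρ 1) (ρ 2) (ρ 3) (ρ 4) (ρ 5)
  sscl-valid static ρ = solve 1 (λ x → ⊥′ if x else ⊥′ ⊜ ⊥′) ≈-refl (ρ 0)
  sscl-valid def-¬ ρ = solve 1 (λ x → ¬′ x ⊜ ⊥′ if x else ⊤′) ≈-refl (ρ 0)
  sscl-valid def-⋏ ρ = solve 2 (λ x y → x ∧′ y ⊜ y if x else ⊥′) ≈-refl (ρ 0) (ρ 1)
  sscl-valid def-⋎ ρ =
    solve 2 (λ x y → x ∨′ y ⊜ ¬′ (¬′ x ∧′ ¬′ y)) ≈-refl (ρ 0) (ρ 1)

  eqSSCL-sound : ∀ {s t} → EqSSCL ⊢ s ≈ t → ∀ ρ → OnSCL.eval s ρ ≈ OnSCL.eval t ρ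
  eqSSCL-sound =
    Soundness.sound setoid _ (λ f → ⟦⟧-cong (includeOp f)) eqSSCL-valid

  sscl-sound : ∀ {s t} → SSCL ⊢ s ≈ t → ∀ ρ → OnSSCL.eval s ρ ≈ OnSSCL.eval t ρ
  sscl-sound = Soundness.sound setoid ⟦_⟧ ⟦⟧-cong sscl-valid

-- Terms modulo derivability, and instances of axioms.

derivability : {Op : ℕ → Set} → Rel (Term Op) 0ℓ → Setoid 0ℓ 0ℓ
derivability {Op} E = record
  { Carrier       = Term Op
  ; _≈_           = E ⊢_≈_
  ; isEquivalence = record { refl = refl ; sym = sym ; trans = trans }
  }

module _ {Op : ℕ → Set} where

  -- The axioms number their variables from 0, so an instance is fixed by listing terms in the order
  -- x, y, z, u, v, w; variables beyond the list stay as they are.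
  assign : List (Term Op) → ℕ → Term Op
  assign []       i       = var i
  assign (t ∷ ts) zero    = t
  assign (t ∷ ts) (suc i) = assign ts i

  instantiate : {E : Rel (Term Op) 0ℓ} {s t : Term Op} → E s t →
                (ts : List (Term Op)) → E ⊢ s [ assign ts ] ≈ t [ assign ts ]
  instantiate e ts = subst (assign ts) (axiom e)

-- The Boolean algebra of terms modulo `EqSSCL`.

module EqSSCLTermAlgebra {A : Set} where

  open ≈-Reasoning (derivability (EqSSCL {A}))

  private
    variable
      x x′ y y′ : SCLTerm A

  ¬-cong : EqSSCL ⊢ x ≈ x′ → EqSSCL ⊢ ¬ x ≈ ¬ x′
  ¬-cong p = cong not (p ∷ [])

  ⋏-cong : EqSSCL ⊢ x ≈ x′ → EqSSCL ⊢ y ≈ y′ → EqSSCL ⊢ x ⋏ y ≈ x′ ⋏ y′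
  ⋏-cong p q = cong and (p ∷ q ∷ [])

  ⋎-cong : EqSSCL ⊢ x ≈ x′ → EqSSCL ⊢ y ≈ y′ → EqSSCL ⊢ x ⋎ y ≈ x′ ⋎ y′
  ⋎-cong p q = cong or (p ∷ q ∷ [])

  ¬-involutive : ∀ x → EqSSCL {A} ⊢ ¬ (¬ x) ≈ x
  ¬-involutive x = instantiate SCL3 (x ∷ [])

  ⋎-def : ∀ x y → EqSSCL {A} ⊢ x ⋎ y ≈ ¬ ((¬ x) ⋏ (¬ y))
  ⋎-def x y = instantiate SCL2 (x ∷ y ∷ [])

  ⋏-identityˡ : ∀ x → EqSSCL {A} ⊢ T ⋏ x ≈ x
  ⋏-identityˡ x = instantiate SCL4 (x ∷ [])

  ⋏-identityʳ : ∀ x → EqSSCL {A} ⊢ x ⋏ T ≈ x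
  ⋏-identityʳ x = instantiate SCL5 (x ∷ [])

  ⋏-zeroʳ : ∀ x → EqSSCL {A} ⊢ x ⋏ F ≈ F
  ⋏-zeroʳ x = instantiate x⋏F≈F (x ∷ [])

  ⋏-assoc : ∀ x y z → EqSSCL {A} ⊢ (x ⋏ y) ⋏ z ≈ x ⋏ (y ⋏ z)
  ⋏-assoc x y z = instantiate SCL7 (x ∷ y ∷ z ∷ [])

  ⋏-absorbs-⋎ : ∀ x y → EqSSCL {A} ⊢ x ⋏ (x ⋎ y) ≈ x
  ⋏-absorbs-⋎ x y = instantiate MSCL1 (x ∷ y ∷ [])

  ⋏-distribˡ-⋎ : ∀ x y z → EqSSCL {A} ⊢ x ⋏ (y ⋎ z) ≈ (x ⋏ y) ⋎ (x ⋏ z)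
  ⋏-distribˡ-⋎ x y z = instantiate MSCL2 (x ∷ y ∷ z ∷ [])

  ¬F≈T : EqSSCL {A} ⊢ ¬ F ≈ T
  ¬F≈T = trans (¬-cong (axiom SCL1)) (¬-involutive T)

  ⋎-identityʳ : ∀ x → EqSSCL {A} ⊢ x ⋎ F ≈ x
  ⋎-identityʳ x = begin
    x ⋎ F                ≈⟨ ⋎-def x F ⟩
    ¬ ((¬ x) ⋏ (¬ F))    ≈⟨ ¬-cong (⋏-cong refl ¬F≈T) ⟩
    ¬ ((¬ x) ⋏ T)        ≈⟨ ¬-cong (⋏-identityʳ (¬ x)) ⟩
    ¬ (¬ x)              ≈⟨ ¬-involutive x ⟩
    x                    ∎

  ⋎-identityˡ : ∀ x → EqSSCL {A} ⊢ F ⋎ x ≈ x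
  ⋎-identityˡ x = begin
    F ⋎ x                ≈⟨ ⋎-def F x ⟩
    ¬ ((¬ F) ⋏ (¬ x))    ≈⟨ ¬-cong (⋏-cong ¬F≈T refl) ⟩
    ¬ (T ⋏ (¬ x))        ≈⟨ ¬-cong (⋏-identityˡ (¬ x)) ⟩
    ¬ (¬ x)              ≈⟨ ¬-involutive x ⟩
    x                    ∎

  ⋏-idem : ∀ x → EqSSCL {A} ⊢ x ⋏ x ≈ x
  ⋏-idem x = trans (⋏-cong refl (sym (⋎-identityʳ x))) (⋏-absorbs-⋎ x F)

  -- Both sides express "if x then y else z", in disjunctive and in conjunctive form; this is
  -- `MSCL4` with u taken to be `T`.
  conditional-cnf : ∀ x y z → EqSSCL {A} ⊢ (x ⋏ y) ⋎ ((¬ x) ⋏ z) ≈ (x ⋎ z) ⋏ ((¬ x) ⋎ y)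
  conditional-cnf x y z = begin
    (x ⋏ y) ⋎ ((¬ x) ⋏ z)              ≈⟨ ⋏-identityʳ _ ⟨
    ((x ⋏ y) ⋎ ((¬ x) ⋏ z)) ⋏ T        ≈⟨ instantiate MSCL4 (x ∷ y ∷ z ∷ T ∷ []) ⟩
    (x ⋎ (z ⋏ T)) ⋏ ((¬ x) ⋎ (y ⋏ T))
      ≈⟨ ⋏-cong (⋎-cong refl (⋏-identityʳ z)) (⋎-cong refl (⋏-identityʳ y)) ⟩
    (x ⋎ z) ⋏ ((¬ x) ⋎ y)              ∎

  -- The left side is the conjunctive form of the conditional with both branches `F`. In its
  -- disjunctive form the axiom `x⋏F≈F` annihilates both disjuncts.
  ⋏-complementʳ : ∀ x → EqSSCL {A} ⊢ x ⋏ (¬ x) ≈ F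
  ⋏-complementʳ x = begin
    x ⋏ (¬ x)                ≈⟨ ⋏-cong (⋎-identityʳ x) (⋎-identityʳ (¬ x)) ⟨
    (x ⋎ F) ⋏ ((¬ x) ⋎ F)    ≈⟨ conditional-cnf x F F ⟨
    (x ⋏ F) ⋎ ((¬ x) ⋏ F)    ≈⟨ ⋎-cong (⋏-zeroʳ x) (⋏-zeroʳ (¬ x)) ⟩
    F ⋎ F                    ≈⟨ ⋎-identityʳ F ⟩
    F                        ∎

  ⋏-complementˡ : ∀ x → EqSSCL {A} ⊢ (¬ x) ⋏ x ≈ F
  ⋏-complementˡ x =
    trans (⋏-cong refl (sym (¬-involutive x))) (⋏-complementʳ (¬ x))

  ⋎-complementʳ : ∀ x → EqSSCL {A} ⊢ x ⋎ (¬ x) ≈ T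
  ⋎-complementʳ x =
    trans (⋎-def x (¬ x)) (trans (¬-cong (⋏-complementʳ (¬ x))) ¬F≈T)

  x⋏[¬x⋎y]≈x⋏y : ∀ x y → EqSSCL {A} ⊢ x ⋏ ((¬ x) ⋎ y) ≈ x ⋏ y
  x⋏[¬x⋎y]≈x⋏y x y = begin
    x ⋏ ((¬ x) ⋎ y)          ≈⟨ ⋏-distribˡ-⋎ x (¬ x) y ⟩
    (x ⋏ (¬ x)) ⋎ (x ⋏ y)    ≈⟨ ⋎-cong (⋏-complementʳ x) refl ⟩
    F ⋎ (x ⋏ y)              ≈⟨ ⋎-identityˡ _ ⟩
    x ⋏ y                    ∎

  -- A first instance of commutation: `MSCL3` swaps disjunctions that begin with complementary
  -- terms, and `x ⋎ F` brings `x` into that shape.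
  x⋏y≈[¬x⋎y]⋏x : ∀ x y → EqSSCL {A} ⊢ x ⋏ y ≈ ((¬ x) ⋎ y) ⋏ x
  x⋏y≈[¬x⋎y]⋏x x y = begin
    x ⋏ y                    ≈⟨ x⋏[¬x⋎y]≈x⋏y x y ⟨
    x ⋏ ((¬ x) ⋎ y)          ≈⟨ ⋏-cong (⋎-identityʳ x) refl ⟨
    (x ⋎ F) ⋏ ((¬ x) ⋎ y)    ≈⟨ instantiate MSCL3 (x ∷ F ∷ y ∷ []) ⟩
    ((¬ x) ⋎ y) ⋏ (x ⋎ F)    ≈⟨ ⋏-cong refl (⋎-identityʳ x) ⟩
    ((¬ x) ⋎ y) ⋏ x          ∎

  -- Once `y` is weakened to `(¬ x) ⋎ y`, the trailing `x` can be moved to the front by the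
  -- preceding lemma, where it merges with the leading one.
  [x⋏y]⋏x≈x⋏y : ∀ x y → EqSSCL {A} ⊢ (x ⋏ y) ⋏ x ≈ x ⋏ y
  [x⋏y]⋏x≈x⋏y x y = begin
    (x ⋏ y) ⋏ x              ≈⟨ ⋏-cong (x⋏[¬x⋎y]≈x⋏y x y) refl ⟨
    (x ⋏ ((¬ x) ⋎ y)) ⋏ x    ≈⟨ ⋏-assoc x _ x ⟩
    x ⋏ (((¬ x) ⋎ y) ⋏ x)    ≈⟨ ⋏-cong refl (x⋏y≈[¬x⋎y]⋏x x y) ⟨
    x ⋏ (x ⋏ y)              ≈⟨ ⋏-assoc x x y ⟨
    (x ⋏ x) ⋏ y              ≈⟨ ⋏-cong (⋏-idem x) refl ⟩
    x ⋏ y                    ∎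

  -- The preceding lemma, read backwards, copies `¬ y` past `x`, where it meets `y`.
  ¬y⋏[x⋏y]≈F : ∀ x y → EqSSCL {A} ⊢ (¬ y) ⋏ (x ⋏ y) ≈ F
  ¬y⋏[x⋏y]≈F x y = begin
    (¬ y) ⋏ (x ⋏ y)              ≈⟨ ⋏-assoc (¬ y) x y ⟨
    ((¬ y) ⋏ x) ⋏ y              ≈⟨ ⋏-cong ([x⋏y]⋏x≈x⋏y (¬ y) x) refl ⟨
    (((¬ y) ⋏ x) ⋏ (¬ y)) ⋏ y    ≈⟨ ⋏-assoc _ (¬ y) y ⟩
    ((¬ y) ⋏ x) ⋏ ((¬ y) ⋏ y)    ≈⟨ ⋏-cong refl (⋏-complementˡ y) ⟩
    ((¬ y) ⋏ x) ⋏ F              ≈⟨ ⋏-zeroʳ _ ⟩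
    F                            ∎

  -- Multiplies `x ⋎ (¬ x)` by `y` on the right. `MSCL4` distributes `y` once the disjuncts are
  -- padded with `T`, and `conditional-cnf` restores the disjunctive form.
  case-split : ∀ x y → EqSSCL {A} ⊢ y ≈ (x ⋏ y) ⋎ ((¬ x) ⋏ y)
  case-split x y = begin
    y                                    ≈⟨ ⋏-identityˡ y ⟨
    T ⋏ y                                ≈⟨ ⋏-cong (⋎-complementʳ x) refl ⟨
    (x ⋎ (¬ x)) ⋏ y
      ≈⟨ ⋏-cong (⋎-cong (⋏-identityʳ x) (⋏-identityʳ (¬ x))) refl ⟨
    ((x ⋏ T) ⋎ ((¬ x) ⋏ T)) ⋏ y          ≈⟨ instantiate MSCL4 (x ∷ T ∷ T ∷ y ∷ []) ⟩
    (x ⋎ (T ⋏ y)) ⋏ ((¬ x) ⋎ (T ⋏ y))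
      ≈⟨ ⋏-cong (⋎-cong refl (⋏-identityˡ y)) (⋎-cong refl (⋏-identityˡ y)) ⟩
    (x ⋎ y) ⋏ ((¬ x) ⋎ y)                ≈⟨ conditional-cnf x y y ⟨
    (x ⋏ y) ⋎ ((¬ x) ⋏ y)                ∎

  -- Split `x ⋏ y` on its second conjunct: the negative case vanishes, and in the positive case the
  -- repeated `y` is dropped.
  ⋏-comm : ∀ x y → EqSSCL {A} ⊢ x ⋏ y ≈ y ⋏ x
  ⋏-comm x y = begin
    x ⋏ y                                  ≈⟨ case-split y (x ⋏ y) ⟩
    (y ⋏ (x ⋏ y)) ⋎ ((¬ y) ⋏ (x ⋏ y))
      ≈⟨ ⋎-cong (sym (⋏-assoc y x y)) (¬y⋏[x⋏y]≈F x y) ⟩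
    ((y ⋏ x) ⋏ y) ⋎ F                      ≈⟨ ⋎-identityʳ _ ⟩
    (y ⋏ x) ⋏ y                            ≈⟨ [x⋏y]⋏x≈x⋏y y x ⟩
    y ⋏ x                                  ∎

  booleanAlgebra : BooleanAlgebra 0ℓ 0ℓ
  booleanAlgebra = DeMorganAlgebra.booleanAlgebra (derivability (EqSSCL {A}))
    (λ x y → x ⋏ y) (λ x y → x ⋎ y) (λ x → ¬ x) T F
    ⋏-cong ¬-cong ¬-involutive (axiom SCL1) ⋎-def ⋏-assoc ⋏-comm ⋏-absorbs-⋎
    ⋏-distribˡ-⋎ ⋏-complementʳ

-- The Boolean algebra of terms modulo `SSCL`.

module SSCLTermAlgebra {A : Set} where

  open ≈-Reasoning (derivability (SSCL {A}))

  private
    variable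
      x x′ y y′ z z′ : SSCLTerm A

  ¬-cong : SSCL ⊢ x ≈ x′ → SSCL ⊢ ¬ x ≈ ¬ x′
  ¬-cong p = cong not (p ∷ [])

  ⋏-cong : SSCL ⊢ x ≈ x′ → SSCL ⊢ y ≈ y′ → SSCL ⊢ x ⋏ y ≈ x′ ⋏ y′
  ⋏-cong p q = cong and (p ∷ q ∷ [])

  cond-cong : SSCL ⊢ x ≈ x′ → SSCL ⊢ y ≈ y′ → SSCL ⊢ z ≈ z′ →
              SSCL ⊢ x ◁ y ▷ z ≈ x′ ◁ y′ ▷ z′
  cond-cong p q r = cong cond (p ∷ q ∷ r ∷ [])

  cond-T : ∀ x y → SSCL {A} ⊢ x ◁ T ▷ y ≈ x
  cond-T x y = instantiate (cpmem CP1) (x ∷ y ∷ [])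

  cond-F : ∀ x y → SSCL {A} ⊢ x ◁ F ▷ y ≈ y
  cond-F x y = instantiate (cpmem CP2) (x ∷ y ∷ [])

  T-cond-F : ∀ x → SSCL {A} ⊢ T ◁ x ▷ F ≈ x
  T-cond-F x = instantiate (cpmem CP3) (x ∷ [])

  cond-cond : ∀ x y z u v →
              SSCL {A} ⊢ x ◁ (y ◁ z ▷ u) ▷ v ≈ (x ◁ y ▷ v) ◁ z ▷ (x ◁ u ▷ v)
  cond-cond x y z u v = instantiate (cpmem CP4) (x ∷ y ∷ z ∷ u ∷ v ∷ [])

  -- In this law and its mirror images, the prefix names the branch of the outer test of `y`; the
  -- suffix `-then` marks a repeated test in the inner then-branch instead of the inner else-branch.
  else-memory : ∀ x y z u v w →
    SSCL {A} ⊢ x ◁ y ▷ (z ◁ u ▷ (v ◁ y ▷ w)) ≈ x ◁ y ▷ (z ◁ u ▷ w)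
  else-memory x y z u v w =
    instantiate (cpmem CPmemax) (x ∷ y ∷ z ∷ u ∷ v ∷ w ∷ [])

  ¬-def : ∀ x → SSCL {A} ⊢ ¬ x ≈ F ◁ x ▷ T
  ¬-def x = instantiate def-¬ (x ∷ [])

  ⋏-def : ∀ x y → SSCL {A} ⊢ x ⋏ y ≈ y ◁ x ▷ F
  ⋏-def x y = instantiate def-⋏ (x ∷ y ∷ [])

  ⋎-def : ∀ x y → SSCL {A} ⊢ x ⋎ y ≈ ¬ ((¬ x) ⋏ (¬ y))
  ⋎-def x y = instantiate def-⋎ (x ∷ y ∷ [])

  F-cond-F : ∀ x → SSCL {A} ⊢ F ◁ x ▷ F ≈ F
  F-cond-F x = instantiate static (x ∷ [])

  -- The source of the mirror images of `else-memory`: negating `y` exchanges the outer branches,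
  -- negating `u` the inner ones.
  cond-¬ : ∀ x y z → SSCL {A} ⊢ x ◁ (¬ y) ▷ z ≈ z ◁ y ▷ x
  cond-¬ x y z = begin
    x ◁ (¬ y) ▷ z                      ≈⟨ cond-cong refl (¬-def y) refl ⟩
    x ◁ (F ◁ y ▷ T) ▷ z                ≈⟨ cond-cond x F y T z ⟩
    (x ◁ F ▷ z) ◁ y ▷ (x ◁ T ▷ z)      ≈⟨ cond-cong (cond-F x z) refl (cond-T x z) ⟩
    z ◁ y ▷ x                          ∎

  then-memory : ∀ x y z u v w →
    SSCL {A} ⊢ (z ◁ u ▷ (v ◁ y ▷ w)) ◁ y ▷ x ≈ (z ◁ u ▷ v) ◁ y ▷ x
  then-memory x y z u v w = begin
    (z ◁ u ▷ (v ◁ y ▷ w)) ◁ y ▷ x            ≈⟨ cond-¬ x y _ ⟨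
    x ◁ (¬ y) ▷ (z ◁ u ▷ (v ◁ y ▷ w))
      ≈⟨ cond-cong refl refl (cond-cong refl refl (cond-¬ w y v)) ⟨
    x ◁ (¬ y) ▷ (z ◁ u ▷ (w ◁ (¬ y) ▷ v))    ≈⟨ else-memory x (¬ y) z u w v ⟩
    x ◁ (¬ y) ▷ (z ◁ u ▷ v)                  ≈⟨ cond-¬ x y _ ⟩
    (z ◁ u ▷ v) ◁ y ▷ x                      ∎

  else-memory-then : ∀ x y z u v w →
    SSCL {A} ⊢ x ◁ y ▷ ((v ◁ y ▷ w) ◁ u ▷ z) ≈ x ◁ y ▷ (w ◁ u ▷ z)
  else-memory-then x y z u v w = begin
    x ◁ y ▷ ((v ◁ y ▷ w) ◁ u ▷ z)        ≈⟨ cond-cong refl refl (cond-¬ z u _) ⟨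
    x ◁ y ▷ (z ◁ (¬ u) ▷ (v ◁ y ▷ w))    ≈⟨ else-memory x y z (¬ u) v w ⟩
    x ◁ y ▷ (z ◁ (¬ u) ▷ w)              ≈⟨ cond-cong refl refl (cond-¬ z u w) ⟩
    x ◁ y ▷ (w ◁ u ▷ z)                  ∎

  then-memory-then : ∀ x y z u v w →
    SSCL {A} ⊢ ((v ◁ y ▷ w) ◁ u ▷ z) ◁ y ▷ x ≈ (v ◁ u ▷ z) ◁ y ▷ x
  then-memory-then x y z u v w = begin
    ((v ◁ y ▷ w) ◁ u ▷ z) ◁ y ▷ x        ≈⟨ cond-cong (cond-¬ z u _) refl refl ⟨
    (z ◁ (¬ u) ▷ (v ◁ y ▷ w)) ◁ y ▷ x    ≈⟨ then-memory x y z (¬ u) v w ⟩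
    (z ◁ (¬ u) ▷ v) ◁ y ▷ x              ≈⟨ cond-cong (cond-¬ z u v) refl refl ⟩
    (v ◁ u ▷ z) ◁ y ▷ x                  ∎

  -- The intervening test of the memory law is taken to be `F`, so it disappears; the `T` in its
  -- dead branch is arbitrary. `else-contract` makes the same choice.
  then-contract : ∀ x y v w → SSCL {A} ⊢ (v ◁ y ▷ w) ◁ y ▷ x ≈ v ◁ y ▷ x
  then-contract x y v w = begin
    (v ◁ y ▷ w) ◁ y ▷ x              ≈⟨ cond-cong (cond-F T _) refl refl ⟨
    (T ◁ F ▷ (v ◁ y ▷ w)) ◁ y ▷ x    ≈⟨ then-memory x y T F v w ⟩
    (T ◁ F ▷ v) ◁ y ▷ x              ≈⟨ cond-cong (cond-F T v) refl refl ⟩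
    v ◁ y ▷ x                        ∎

  else-contract : ∀ x y v w → SSCL {A} ⊢ x ◁ y ▷ (v ◁ y ▷ w) ≈ x ◁ y ▷ w
  else-contract x y v w = begin
    x ◁ y ▷ (v ◁ y ▷ w)              ≈⟨ cond-cong refl refl (cond-F T _) ⟨
    x ◁ y ▷ (T ◁ F ▷ (v ◁ y ▷ w))    ≈⟨ else-memory x y T F v w ⟩
    x ◁ y ▷ (T ◁ F ▷ w)              ≈⟨ cond-cong refl refl (cond-F T w) ⟩
    x ◁ y ▷ w                        ∎

  -- Extends the static axiom from `F` to any `x`: with `x` written as `x ◁ F ▷ x`, `CP4` moves the
  -- test of `y` into the condition, where it becomes `F ◁ y ▷ F`.
  cond-idem : ∀ x y → SSCL {A} ⊢ x ◁ y ▷ x ≈ x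
  cond-idem x y = begin
    x ◁ y ▷ x                        ≈⟨ cond-cong (cond-F x x) refl (cond-F x x) ⟨
    (x ◁ F ▷ x) ◁ y ▷ (x ◁ F ▷ x)    ≈⟨ cond-cond x F y F x ⟨
    x ◁ (F ◁ y ▷ F) ▷ x              ≈⟨ cond-cong refl (F-cond-F y) refl ⟩
    x ◁ F ▷ x                        ≈⟨ cond-F x x ⟩
    x                                ∎

  ⋎-cond : ∀ x y → SSCL {A} ⊢ x ⋎ y ≈ T ◁ x ▷ y
  ⋎-cond x y = begin
    x ⋎ y                                  ≈⟨ ⋎-def x y ⟩
    ¬ ((¬ x) ⋏ (¬ y))                      ≈⟨ ¬-def _ ⟩
    F ◁ ((¬ x) ⋏ (¬ y)) ▷ T
      ≈⟨ cond-cong refl (trans (⋏-def _ _) (cond-¬ _ x F)) refl ⟩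
    F ◁ (F ◁ x ▷ (¬ y)) ▷ T                ≈⟨ cond-cond F F x (¬ y) T ⟩
    (F ◁ F ▷ T) ◁ x ▷ (F ◁ (¬ y) ▷ T)
      ≈⟨ cond-cong (cond-F F T) refl (trans (cond-¬ F y T) (T-cond-F y)) ⟩
    T ◁ x ▷ y                              ∎

  ¬-involutive : ∀ x → SSCL {A} ⊢ ¬ (¬ x) ≈ x
  ¬-involutive x = trans (¬-def (¬ x)) (trans (cond-¬ F x T) (T-cond-F x))

  ⋏-assoc : ∀ x y z → SSCL {A} ⊢ (x ⋏ y) ⋏ z ≈ x ⋏ (y ⋏ z)
  ⋏-assoc x y z = begin
    (x ⋏ y) ⋏ z                      ≈⟨ ⋏-def _ z ⟩
    z ◁ (x ⋏ y) ▷ F                  ≈⟨ cond-cong refl (⋏-def x y) refl ⟩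
    z ◁ (y ◁ x ▷ F) ▷ F              ≈⟨ cond-cond z y x F F ⟩
    (z ◁ y ▷ F) ◁ x ▷ (z ◁ F ▷ F)    ≈⟨ cond-cong (sym (⋏-def y z)) refl (cond-F z F) ⟩
    (y ⋏ z) ◁ x ▷ F                  ≈⟨ ⋏-def x _ ⟨
    x ⋏ (y ⋏ z)                      ∎

  -- A test of `y` is put in front by `cond-idem`. Memory then resolves the later test of `y` in
  -- both branches, leaving `T ◁ x ▷ F` and `F ◁ x ▷ F`; the latter is `F` by the static axiom.
  ⋏-comm : ∀ x y → SSCL {A} ⊢ x ⋏ y ≈ y ⋏ x
  ⋏-comm x y = begin
    x ⋏ y                                                  ≈⟨ ⋏-def x y ⟩
    y ◁ x ▷ F
      ≈⟨ cond-cong (T-cond-F y) refl refl ⟨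
    (T ◁ y ▷ F) ◁ x ▷ F                                    ≈⟨ cond-idem _ y ⟨
    ((T ◁ y ▷ F) ◁ x ▷ F) ◁ y ▷ ((T ◁ y ▷ F) ◁ x ▷ F)      ≈⟨ then-memory-then _ y F x T F ⟩
    (T ◁ x ▷ F) ◁ y ▷ ((T ◁ y ▷ F) ◁ x ▷ F)                ≈⟨ else-memory-then _ y F x T F ⟩
    (T ◁ x ▷ F) ◁ y ▷ (F ◁ x ▷ F)
      ≈⟨ cond-cong (T-cond-F x) refl (F-cond-F x) ⟩
    x ◁ y ▷ F                                              ≈⟨ ⋏-def y x ⟨
    y ⋏ x                                                  ∎

  ⋏-absorbs-⋎ : ∀ x y → SSCL {A} ⊢ x ⋏ (x ⋎ y) ≈ x
  ⋏-absorbs-⋎ x y = begin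
    x ⋏ (x ⋎ y)            ≈⟨ ⋏-def x _ ⟩
    (x ⋎ y) ◁ x ▷ F        ≈⟨ cond-cong (⋎-cond x y) refl refl ⟩
    (T ◁ x ▷ y) ◁ x ▷ F    ≈⟨ then-contract F x T y ⟩
    T ◁ x ▷ F              ≈⟨ T-cond-F x ⟩
    x                      ∎

  -- The plan is to apply `CP4` backwards, for which both branches of the test of `x` must have the
  -- form `T ◁ _ ▷ (z ◁ x ▷ F)`. Memory and contraction, read backwards, insert the extra tests of
  -- `x`.
  ⋏-distribˡ-⋎ : ∀ x y z → SSCL {A} ⊢ x ⋏ (y ⋎ z) ≈ (x ⋏ y) ⋎ (x ⋏ z)
  ⋏-distribˡ-⋎ x y z = begin
    x ⋏ (y ⋎ z)                                            ≈⟨ ⋏-def x _ ⟩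
    (y ⋎ z) ◁ x ▷ F
      ≈⟨ cond-cong (⋎-cond y z) refl refl ⟩
    (T ◁ y ▷ z) ◁ x ▷ F                                    ≈⟨ else-contract _ x z F ⟨
    (T ◁ y ▷ z) ◁ x ▷ (z ◁ x ▷ F)                          ≈⟨ then-memory _ x T y z F ⟨
    (T ◁ y ▷ (z ◁ x ▷ F)) ◁ x ▷ (z ◁ x ▷ F)
      -- A vacuous test of `F` gives the else-branch the shape of the then-branch.
      ≈⟨ cond-cong refl refl (cond-F T _) ⟨
    (T ◁ y ▷ (z ◁ x ▷ F)) ◁ x ▷ (T ◁ F ▷ (z ◁ x ▷ F))      ≈⟨ cond-cond T y x F _ ⟨
    T ◁ (y ◁ x ▷ F) ▷ (z ◁ x ▷ F)
      ≈⟨ cond-cong refl (⋏-def x y) (⋏-def x z) ⟨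
    T ◁ (x ⋏ y) ▷ (x ⋏ z)                                  ≈⟨ ⋎-cond _ _ ⟨
    (x ⋏ y) ⋎ (x ⋏ z)                                      ∎

  ⋏-complementʳ : ∀ x → SSCL {A} ⊢ x ⋏ (¬ x) ≈ F
  ⋏-complementʳ x = begin
    x ⋏ (¬ x)              ≈⟨ ⋏-def x _ ⟩
    (¬ x) ◁ x ▷ F          ≈⟨ cond-cong (¬-def x) refl refl ⟩
    (F ◁ x ▷ T) ◁ x ▷ F    ≈⟨ then-contract F x F T ⟩
    F ◁ x ▷ F              ≈⟨ F-cond-F x ⟩
    F                      ∎

  F≈¬T : SSCL {A} ⊢ F ≈ ¬ T
  F≈¬T = sym (trans (¬-def T) (cond-T F T))

  booleanAlgebra : BooleanAlgebra 0ℓ 0ℓ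
  booleanAlgebra = DeMorganAlgebra.booleanAlgebra (derivability (SSCL {A}))
    (λ x y → x ⋏ y) (λ x y → x ⋎ y) (λ x → ¬ x) T F
    ⋏-cong ¬-cong ¬-involutive F≈¬T ⋎-def ⋏-assoc ⋏-comm ⋏-absorbs-⋎
    ⋏-distribˡ-⋎ ⋏-complementʳ

-- Transfer of derivations through the term algebras.

module _ {A : Set} where

  module InSSCL =
    BooleanModel (SSCLTermAlgebra.booleanAlgebra {A}) (λ a → op (atom a) [])
  module InEqSSCL =
    BooleanModel (EqSSCLTermAlgebra.booleanAlgebra {A}) (λ a → op (atom a) [])

  -- The operations of the term algebra are the term constructors themselves, so evaluation at `var`
  -- merely rebuilds the term.
  eval-include : (t : SCLTerm A) → InSSCL.OnSCL.eval t var ≡ include t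
  eval-include (var i)  = ≡.refl
  eval-include T        = ≡.refl
  eval-include F        = ≡.refl
  eval-include (op (atom a) []) = ≡.refl
  eval-include (¬ s)    = ≡.cong (λ x → ¬ x) (eval-include s)
  eval-include (s ⋏ t)  = ≡.cong₂ (λ x y → x ⋏ y) (eval-include s) (eval-include t)
  eval-include (s ⋎ t)  = ≡.cong₂ (λ x y → x ⋎ y) (eval-include s) (eval-include t)

  -- Evaluation here rewrites conditionals by `_⋏_`, `_⋎_` and `¬_`; included terms contain none and
  -- come back unchanged.
  include-eval : (t : SCLTerm A) → InEqSSCL.OnSSCL.eval (include t) var ≡ t
  include-eval (var i)  = ≡.refl
  include-eval T        = ≡.refl
  include-eval F        = ≡.refl
  include-eval (op (atom a) []) = ≡.refl
  include-eval (¬ s)    = ≡.cong (λ x → ¬ x) (include-eval s)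
  include-eval (s ⋏ t)  = ≡.cong₂ (λ x y → x ⋏ y) (include-eval s) (include-eval t)
  include-eval (s ⋎ t)  = ≡.cong₂ (λ x y → x ⋎ y) (include-eval s) (include-eval t)

theorem9 : (A : Set) → A ↣ ℕ → (t t′ : SCLTerm A) →
    (EqSSCL ⊢ t ≈ t′) ⇔ (SSCL ⊢ include t ≈ include t′)
theorem9 A _ t t′ = mk⇔
  (λ p → ≡.subst₂ (SSCL ⊢_≈_) (eval-include t) (eval-include t′)
           (InSSCL.eqSSCL-sound p var))
  -- The derivation may pass through terms with conditionals; soundness in the model eliminates them
  -- along the way.
  (λ p → ≡.subst₂ (EqSSCL ⊢_≈_) (include-eval t) (include-eval t′)
           (InEqSSCL.sscl-sound p var))
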